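{- Let $f_0, f_1, \dots, f_{n-1}$ be the frequencies of the $n$ distinct elements of a multiset, let $N = \sum_{i=0}^{n-1} f_i$, and let $B$ be a positive integer. For integers $c$ with $0 \leq c \leq B-1$ define $$E_c := \frac{1}{(B-c)N}\left(\left(\sum_{i=c}^{n-1} f_i\right)^2 - \sum_{i=c}^{n-1} f_i^2\right).$$ If $f_0 \geq f_1 \geq \dots \geq f_{n-1} > 0$ holds, then $E_c$, as a function of $c$, has at most one local minimum.
   Context: The elements of the multiset are labelled $0, 1, \dots, n-1$; $f_i$ is the number of occurrences of element $i$ in the multiset (so $f_i$ is an integer), and $N$ is the size of the multiset. $B$ is the total capacity (number of array cells) of a learned Count-Min Sketch, a data structure in which $c$ cells are used to count the elements $0, 1, \dots, c-1$ exactly and the remaining elements are stored in a Count-Min Sketch, here with a single hash function and $B-c$ cells. With $\tilde f_i$ denoting the estimated frequency of element $i$, $E_c$ is the expected value of the weighted error $\frac{1}{N}\sum_{i} |\tilde f_i - f_i| \cdot f_i$ of this data structure. -}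

module Defs where

open import Data.Nat.Base as ℕ using (ℕ; zero; suc; NonZero; >-nonZero)
import Data.Nat.Properties as ℕ
open import Data.Nat.ListAction using (sum)
open import Data.Integer.Base as ℤ using (+_)
open import Data.Rational.Base as ℚ using (ℚ)
open import Data.Fin.Base as Fin using (Fin; zero; suc; toℕ)
import Data.Fin.Properties as Fin
open import Data.List.Base using (drop; tabulate)
open import Data.Sum.Base using (_⊎_)
open import Relation.Binary.PropositionalEquality.Core using (_≡_)

-- Σ_{i=c}^{n-1} g i; this is the empty sum when c ≥ n.
sumFrom : ∀ {n} → ℕ → (Fin n → ℕ) → ℕ
sumFrom c g = sum (drop c (tabulate g))

total : ∀ {n} → (Fin n → ℕ) → ℕ
total f = sumFrom 0 f

≤-total : ∀ {n} (f : Fin n → ℕ) i → f i ℕ.≤ total f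
≤-total f zero    = ℕ.m≤m+n (f zero) _
≤-total f (suc i) = ℕ.≤-trans (≤-total (λ j → f (suc j)) i) (ℕ.m≤n+m _ (f zero))

total-nonZero : ∀ {n} (f : Fin n → ℕ) i → 0 ℕ.< f i → NonZero (total f)
total-nonZero f i 0<fi = >-nonZero (ℕ.<-≤-trans 0<fi (≤-total f i))

-- The subtraction in the numerator is that of ℤ; in the denominator ∸ is
-- not truncated since c < B.
E : ∀ {n} (f : Fin n → ℕ) .{{_ : NonZero (total f)}} (B : ℕ) → Fin B → ℚ
E f B c = (+ (sumFrom k f ℕ.^ 2) ℤ.- + sumFrom k (λ i → f i ℕ.^ 2))
          ℚ./ ((B ℕ.∸ k) ℕ.* total f)
  where
  k = toℕ c
  instance
    B∸k≢0 : NonZero (B ℕ.∸ k)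
    B∸k≢0 = >-nonZero (ℕ.m<n⇒0<n∸m (Fin.toℕ<n c))
    denominator≢0 : NonZero ((B ℕ.∸ k) ℕ.* total f)
    denominator≢0 = ℕ.m*n≢0 (B ℕ.∸ k) (total f)

Adjacent : ∀ {B} → Fin B → Fin B → Set
Adjacent c d = toℕ d ≡ suc (toℕ c) ⊎ toℕ c ≡ suc (toℕ d)

-- An endpoint of the domain is compared with its only neighbour.
IsLocalMinimum : ∀ {B} → (Fin B → ℚ) → Fin B → Set
IsLocalMinimum g c = ∀ d → Adjacent c d → g c ℚ.≤ g d

-- Since IsLocalMinimum is non-strict, every point of a flat bottom satisfies it,
-- and such a bottom counts as a single local minimum: any two local minima are
-- joined by a run on which g is constant.  (Uniqueness of the point itself fails
-- for E: if f = (1,1,1,1) and B = 2 then E 0 = E 1, and E c = 0 for all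
-- c ≥ n - 1.)  In particular there is at most one strict local minimum.
AtMostOneLocalMinimum : ∀ {B} → (Fin B → ℚ) → Set
AtMostOneLocalMinimum g =
  ∀ c d → IsLocalMinimum g c → IsLocalMinimum g d →
  ∀ e → c Fin.≤ e → e Fin.≤ d → g e ≡ g c

{-# OPTIONS --safe #-}

-- With P_c = (Σ_{i≥c} f_i)² − Σ_{i≥c} f_i² and t_c = 2 f_c Σ_{i>c} f_i one has
-- P_c = P_{c+1} + t_c, so E_c ≤ E_{c+1} iff t_c (B − c − 1) ≤ P_{c+1}, and
-- E_{c+1} ≤ E_{c+2} iff t_{c+1} (B − c − 2) ≤ P_{c+2}, where the latter is
-- equivalent to t_{c+1} (B − c − 1) ≤ P_{c+1}.  As f is nonincreasing, so is t.
-- Hence E_c ≤ E_{c+1} implies E_{c+1} ≤ E_{c+2}, and in the same way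
-- E_{c+1} ≥ E_{c+2} implies E_c ≥ E_{c+1}.  Between two local minima E is
-- therefore both nondecreasing and nonincreasing.

module Submission where

open import Data.Fin.Base as Fin using (Fin; zero; suc; toℕ; fromℕ)
import Data.Fin.Properties as Fin
open import Data.Integer.Base as ℤ using (+_)
import Data.Integer.Properties as ℤ
open import Data.List.Base using (List; []; _∷_; drop; map; tabulate)
open import Data.List.Properties using (drop-drop; drop-map; map-tabulate)
open import Data.List.Relation.Unary.All using (_∷_)
open import Data.List.Relation.Unary.AllPairs using (AllPairs; []; _∷_)
open import Data.List.Relation.Unary.AllPairs.Properties using (drop⁺; tabulate⁺-<)
open import Data.Nat.Base
  using (ℕ; suc; _+_; _*_; _∸_; _^_; _≤_; _<_; _≥_; z≤n; s≤s; NonZero; >-nonZero)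
open import Data.Nat.ListAction using (sum)
open import Data.Nat.Properties
open import Data.Nat.Tactic.RingSolver using (solve-∀)
open import Data.Product.Base using (_×_; _,_; proj₁; proj₂)
open import Data.Rational.Base as ℚ using (ℚ; _/_)
import Data.Rational.Properties as ℚ
open import Data.Rational.Unnormalised.Base as ℚᵘ using (mkℚᵘ)
import Data.Rational.Unnormalised.Properties as ℚᵘ
open import Data.Sum.Base using (inj₁; inj₂)
open import Function.Base using (flip; id; _∘_)
open import Function.Bundles using (_⇔_; mk⇔; Equivalence)
open import Relation.Binary.Construct.Closure.ReflexiveTransitive
  using (Star; ε; _◅_; gmap; reverse)
open import Relation.Binary.Core using (Rel; _Preserves_⟶_)
open import Relation.Binary.PropositionalEquality
open import Defs

open Equivalence using (to; from)

_⋖_ : ∀ {n} → Rel (Fin n) _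
i ⋖ j = toℕ j ≡ suc (toℕ i)

≤⇒⋖* : ∀ {n} {i j : Fin n} → i Fin.≤ j → Star _⋖_ i j
≤⇒⋖* {i = zero} {zero} _ = ε
≤⇒⋖* {suc (suc n)} {zero} {suc j} _ = refl ◅ gmap suc (cong suc) (≤⇒⋖* z≤n)
≤⇒⋖* {i = suc i} {suc j} (s≤s i≤j) = gmap suc (cong suc) (≤⇒⋖* i≤j)

NondecreasingAt : ∀ {a ℓ} {A : Set a} → Rel A ℓ → (A → ℚ) → A → Set _
NondecreasingAt _⟶_ g x = ∀ y → x ⟶ y → g x ℚ.≤ g y

-- The relation is a parameter so that one induction serves both directions: `_⋖_` walks to the
-- right, its flip to the left.
KeepsRising : ∀ {a ℓ} {A : Set a} → Rel A ℓ → (A → ℚ) → Set _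
KeepsRising _⟶_ g = ∀ {x y z} → x ⟶ y → y ⟶ z → g x ℚ.≤ g y → g y ℚ.≤ g z

-- Induction on the path: `keeps` hands the rise at each point on to the next. The second component
-- lets a walk be resumed where it ended.
rise : ∀ {a ℓ} {A : Set a} {_⟶_ : Rel A ℓ} {g : A → ℚ} → KeepsRising _⟶_ g →
       ∀ {x y} → NondecreasingAt _⟶_ g x → Star _⟶_ x y →
       g x ℚ.≤ g y × NondecreasingAt _⟶_ g y
rise keeps gx≤ ε = ℚ.≤-refl , gx≤
rise keeps gx≤ (x⟶y ◅ y⟶*z) =
  let gy≤gz , gz≤ = rise keeps (λ w y⟶w → keeps x⟶y y⟶w (gx≤ _ x⟶y)) y⟶*z
  in ℚ.≤-trans (gx≤ _ x⟶y) gy≤gz , gz≤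

keepsRising⇒atMostOneLocalMinimum :
  ∀ {n} {g : Fin n → ℚ} → KeepsRising _⋖_ g → KeepsRising (flip _⋖_) g →
  AtMostOneLocalMinimum g
keepsRising⇒atMostOneLocalMinimum {g = g} up down c d c-min d-min e c≤e e≤d =
  -- `c-min` makes `g` rise to the right through `e` up to `d`, and `d-min` makes it rise to the
  -- left from `d` back to `c`; this cycle of inequalities forces equality.
  ℚ.≤-antisym (ℚ.≤-trans ge≤gd gd≤gc) gc≤ge
  where
  c⋖*e = ≤⇒⋖* c≤e
  c-rises = rise up (λ y → c-min y ∘ inj₁) c⋖*e
  gc≤ge = proj₁ c-rises
  ge≤gd = proj₁ (rise up (proj₂ c-rises) (≤⇒⋖* e≤d))
  gd≤gc = proj₁ (rise down (λ y → d-min y ∘ inj₂)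
                           (reverse id (≤⇒⋖* (≤-trans c≤e e≤d))))

-- On the tail from c this is P_c, twice the sum of products over pairs of positions; the recursion
-- adds t_c. Having no subtraction, it keeps the later inequalities in `ℕ`.
crossTerms : List ℕ → ℕ
crossTerms []       = 0
crossTerms (x ∷ xs) = crossTerms xs + 2 * (x * sum xs)

sum-^2 : ∀ xs → sum xs ^ 2 ≡ crossTerms xs + sum (map (_^ 2) xs)
sum-^2 []       = refl
sum-^2 (x ∷ xs) = begin
  (x + s) ^ 2                      ≡⟨ binomial x s ⟩
  s ^ 2 + (2 * (x * s) + x ^ 2)    ≡⟨ cong (_+ (2 * (x * s) + x ^ 2)) (sum-^2 xs) ⟩
  p + q + (2 * (x * s) + x ^ 2)    ≡⟨ regroup p q (2 * (x * s)) (x ^ 2) ⟩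
  p + 2 * (x * s) + (x ^ 2 + q)    ∎
  where
  open ≡-Reasoning
  s = sum xs
  p = crossTerms xs
  q = sum (map (_^ 2) xs)
  -- solve-∀ does not normalise _^_; a * (a * 1) is the unfolding of a ^ 2.
  binomial : ∀ a b → (a + b) * ((a + b) * 1) ≡ b * (b * 1) + (2 * (a * b) + a * (a * 1))
  binomial = solve-∀
  regroup : ∀ a b c d → a + b + (c + d) ≡ a + c + (d + b)
  regroup = solve-∀

-- For m = P_{c+1}, t = t_c and k = B - c - 1 the left side is E_c ≤ E_{c+1} cross-multiplied;
-- `m * k` cancels.
[m+t]*k≤m*[1+k]⇔t*k≤m : ∀ m t k → (m + t) * k ≤ m * suc k ⇔ t * k ≤ m
[m+t]*k≤m*[1+k]⇔t*k≤m m t k = mk⇔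
  (λ le → +-cancelˡ-≤ (m * k) _ _ (subst₂ _≤_ lhs rhs le))
  (λ le → subst₂ _≤_ (sym lhs) (sym rhs) (+-monoʳ-≤ (m * k) le))
  where
  lhs = *-distribʳ-+ k m t
  rhs = trans (*-suc m k) (+-comm m (m * k))

m*[1+k]≤[m+t]*k⇔m≤t*k : ∀ m t k → m * suc k ≤ (m + t) * k ⇔ m ≤ t * k
m*[1+k]≤[m+t]*k⇔m≤t*k m t k = mk⇔
  (λ le → +-cancelˡ-≤ (m * k) _ _ (subst₂ _≤_ rhs lhs le))
  (λ le → subst₂ _≤_ (sym rhs) (sym lhs) (+-monoʳ-≤ (m * k) le))
  where
  lhs = *-distribʳ-+ k m t
  rhs = trans (*-suc m k) (+-comm m (m * k))

crossTerm-antitone : ∀ {a b} u → b ≤ a → 2 * (b * u) ≤ 2 * (a * (b + u))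
crossTerm-antitone {b = b} u b≤a = *-monoʳ-≤ 2 (*-mono-≤ b≤a (m≤n+m u b))

crossTerms-keepsRising : ∀ xs k → AllPairs _≥_ xs →
  crossTerms xs * suc k ≤ crossTerms (drop 1 xs) * suc (suc k) →
  crossTerms (drop 1 xs) * k ≤ crossTerms (drop 2 xs) * suc k
crossTerms-keepsRising []           k _ _ = z≤n
crossTerms-keepsRising (a ∷ [])     k _ _ = z≤n
crossTerms-keepsRising (a ∷ b ∷ xs) k ((b≤a ∷ _) ∷ _) le =
  -- Adding `t` to both sides turns the factor `k` into the `suc k` of the hypothesis, so only `t`
  -- and `t′` remain to be compared.
  from ([m+t]*k≤m*[1+k]⇔t*k≤m p t k) (+-cancelˡ-≤ t _ _ (begin
    t + t * k  ≡⟨ *-suc t k ⟨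
    t * suc k  ≤⟨ *-monoˡ-≤ (suc k) (crossTerm-antitone (sum xs) b≤a) ⟩
    t′ * suc k ≤⟨ to ([m+t]*k≤m*[1+k]⇔t*k≤m (p + t) t′ (suc k)) le ⟩
    p + t      ≡⟨ +-comm p t ⟩
    t + p      ∎))
  where
  open ≤-Reasoning
  p  = crossTerms xs
  t  = 2 * (b * sum xs)
  t′ = 2 * (a * (b + sum xs))

-- From `p ≤ t * k`, adding `t` gives `p + t ≤ t * suc k`, and `t ≤ t′` only enlarges the right
-- side.
crossTerms-keepsRising-backwards : ∀ xs k → AllPairs _≥_ xs →
  crossTerms (drop 2 xs) * suc k ≤ crossTerms (drop 1 xs) * k →
  crossTerms (drop 1 xs) * suc (suc k) ≤ crossTerms xs * suc k
crossTerms-keepsRising-backwards []           k _ _ = z≤n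
crossTerms-keepsRising-backwards (a ∷ [])     k _ _ = z≤n
crossTerms-keepsRising-backwards (a ∷ b ∷ xs) k ((b≤a ∷ _) ∷ _) le =
  from (m*[1+k]≤[m+t]*k⇔m≤t*k (p + t) t′ (suc k)) (begin
    p + t      ≤⟨ +-monoˡ-≤ t (to (m*[1+k]≤[m+t]*k⇔m≤t*k p t k) le) ⟩
    t * k + t  ≡⟨ +-comm (t * k) t ⟩
    t + t * k  ≡⟨ *-suc t k ⟨
    t * suc k  ≤⟨ *-monoˡ-≤ (suc k) (crossTerm-antitone (sum xs) b≤a) ⟩
    t′ * suc k ∎)
  where
  open ≤-Reasoning
  p  = crossTerms xs
  t  = 2 * (b * sum xs)
  t′ = 2 * (a * (b + sum xs))

-- `_/_` reduces to lowest terms, so the comparison passes through unnormalised rationals, whose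
-- order is cross-multiplication.
+/-≤⇔ : ∀ a b c d .{{_ : NonZero b}} .{{_ : NonZero d}} →
        (+ a / b) ℚ.≤ (+ c / d) ⇔ a * d ≤ c * b
+/-≤⇔ a b@(suc b-1) c d@(suc d-1) = mk⇔
  (λ le → ℤ.drop‿+≤+ (subst₂ ℤ._≤_ (sym (ℤ.pos-* a d)) (sym (ℤ.pos-* c b))
    (ℚᵘ.drop-*≤* (ℚᵘ.≤-respˡ-≃ p≃ (ℚᵘ.≤-respʳ-≃ q≃ (ℚ.toℚᵘ-mono-≤ le))))))
  (λ le → ℚ.toℚᵘ-cancel-≤ (ℚᵘ.≤-respˡ-≃ (ℚᵘ.≃-sym p≃) (ℚᵘ.≤-respʳ-≃ (ℚᵘ.≃-sym q≃)
    (ℚᵘ.*≤* (subst₂ ℤ._≤_ (ℤ.pos-* a d) (ℤ.pos-* c b) (ℤ.+≤+ le))))))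
  where
  p≃ = ℚ.toℚᵘ-fromℚᵘ (mkℚᵘ (+ a) b-1)
  q≃ = ℚ.toℚᵘ-fromℚᵘ (mkℚᵘ (+ c) d-1)

module _ {n} (f : Fin n → ℕ) where

  tail : ℕ → List ℕ
  tail k = drop k (tabulate f)

  numerator : ∀ k → + (sumFrom k f ^ 2) ℤ.- + sumFrom k (λ i → f i ^ 2) ≡ + crossTerms (tail k)
  numerator k = begin
    + (sum (tail k) ^ 2) ℤ.- + sumFrom k (λ i → f i ^ 2)
      ≡⟨ cong₂ (λ x y → + x ℤ.- + y) (sum-^2 (tail k)) squares ⟩
    + (p + q) ℤ.- + q
      ≡⟨ ℤ.[+m]-[+n]≡m⊖n (p + q) q ⟩
    (p + q) ℤ.⊖ q
      -- Since `q ≤ p + q`, the integer difference is a natural number.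
      ≡⟨ ℤ.⊖-≥ (m≤n+m q p) ⟩
    + (p + q ∸ q)
      ≡⟨ cong +_ (m+n∸n≡m p q) ⟩
    + p ∎
    where
    open ≡-Reasoning
    p = crossTerms (tail k)
    q = sum (map (_^ 2) (tail k))
    squares : sumFrom k (λ i → f i ^ 2) ≡ q
    squares = cong sum (trans (cong (drop k) (sym (map-tabulate f (_^ 2))))
                              (drop-map k (tabulate f)))

  module _ .{{_ : NonZero (total f)}} {B : ℕ} where

    E-≤⇔ : ∀ (i j : Fin B) → E f B i ℚ.≤ E f B j ⇔
           crossTerms (tail (toℕ i)) * (B ∸ toℕ j) ≤ crossTerms (tail (toℕ j)) * (B ∸ toℕ i)
    E-≤⇔ i j rewrite numerator (toℕ i) | numerator (toℕ j) = mk⇔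
      (λ le → *-cancelʳ-≤ _ _ N (subst₂ _≤_ (sym (*-assoc p b N)) (sym (*-assoc q a N)) (to ≤⇔ le)))
      (λ le → from ≤⇔ (subst₂ _≤_ (*-assoc p b N) (*-assoc q a N) (*-monoˡ-≤ N le)))
      where
      N = total f
      p = crossTerms (tail (toℕ i))
      q = crossTerms (tail (toℕ j))
      a = B ∸ toℕ i
      b = B ∸ toℕ j
      instance
        a≢0 : NonZero a
        a≢0 = >-nonZero (m<n⇒0<n∸m (Fin.toℕ<n i))
        b≢0 : NonZero b
        b≢0 = >-nonZero (m<n⇒0<n∸m (Fin.toℕ<n j))
      ≤⇔ = +/-≤⇔ p (a * N) q (b * N) {{m*n≢0 a N}} {{m*n≢0 b N}}

    tail-⋖ : ∀ {i j : Fin B} → i ⋖ j → tail (toℕ j) ≡ drop 1 (tail (toℕ i))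
    tail-⋖ {i} i⋖j = trans (cong tail (trans i⋖j (+-comm 1 (toℕ i))))
                           (sym (drop-drop (toℕ i) 1 (tabulate f)))

    ∸-⋖ : ∀ {i j : Fin B} → i ⋖ j → B ∸ toℕ i ≡ suc (B ∸ toℕ j)
    -- `suc B ∸ suc (toℕ i)` computes to `B ∸ toℕ i`, and `toℕ i < B` rules out truncation.
    ∸-⋖ {i} i⋖j = trans (+-∸-assoc 1 (Fin.toℕ<n i)) (cong (λ k → suc (B ∸ k)) (sym i⋖j))

    -- Kept as equations so that `At⇒E-≤⇔` can match on `refl`; three consecutive points are then
    -- described by the first tail and the last value of `B ∸ toℕ z`.
    At : Fin B → List ℕ → ℕ → Set
    At i xs k = tail (toℕ i) ≡ xs × B ∸ toℕ i ≡ k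

    At-⋖-⋖ : ∀ {x y z : Fin B} → x ⋖ y → y ⋖ z →
             let xs = tail (toℕ x); k = B ∸ toℕ z in
             At x xs (2 + k) × At y (drop 1 xs) (1 + k) × At z (drop 2 xs) k
    At-⋖-⋖ {x} x⋖y y⋖z =
      (refl , trans (∸-⋖ x⋖y) (cong suc (∸-⋖ y⋖z))) ,
      (tail-⋖ x⋖y , ∸-⋖ y⋖z) ,
      (trans (tail-⋖ y⋖z) (trans (cong (drop 1) (tail-⋖ x⋖y))
                                 (drop-drop 1 1 (tail (toℕ x)))) , refl)

    At⇒E-≤⇔ : ∀ i j {xs ys k l} → At i xs k → At j ys l →
              E f B i ℚ.≤ E f B j ⇔ crossTerms xs * l ≤ crossTerms ys * k
    At⇒E-≤⇔ i j (refl , refl) (refl , refl) = E-≤⇔ i j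

    module _ (antitone : f Preserves Fin._≤_ ⟶ _≥_) where

      tail-sorted : ∀ k → AllPairs _≥_ (tail k)
      tail-sorted k = drop⁺ k (tabulate⁺-< (antitone ∘ <⇒≤))

      E-keepsRising : KeepsRising _⋖_ (E f B)
      E-keepsRising {x} {y} {z} x⋖y y⋖z le =
        let at-x , at-y , at-z = At-⋖-⋖ x⋖y y⋖z in
        from (At⇒E-≤⇔ y z at-y at-z)
          (crossTerms-keepsRising (tail (toℕ x)) (B ∸ toℕ z) (tail-sorted (toℕ x))
            (to (At⇒E-≤⇔ x y at-x at-y) le))

      E-keepsRising-backwards : KeepsRising (flip _⋖_) (E f B)
      -- The flipped relation lists points from right to left; with these names `x` is again the
      -- leftmost.
      E-keepsRising-backwards {z} {y} {x} y⋖z x⋖y le =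
        let at-x , at-y , at-z = At-⋖-⋖ x⋖y y⋖z in
        from (At⇒E-≤⇔ y x at-y at-x)
          (crossTerms-keepsRising-backwards (tail (toℕ x)) (B ∸ toℕ z) (tail-sorted (toℕ x))
            (to (At⇒E-≤⇔ z y at-z at-y) le))

theorem1 : (m : ℕ) (f : Fin (suc m) → ℕ) (B : ℕ) .{{_ : NonZero B}} →
    f Preserves Fin._≤_ ⟶ _≥_ →
    (f-last>0 : 0 < f (fromℕ m)) →
    AtMostOneLocalMinimum (E f {{total-nonZero f (fromℕ m) f-last>0}} B)
theorem1 m f B antitone f-last>0 =
  keepsRising⇒atMostOneLocalMinimum (E-keepsRising f antitone)
                                    (E-keepsRising-backwards f antitone)
  where
  instance
    N≢0 : NonZero (total f)
    N≢0 = total-nonZero f (fromℕ m) f-last>0
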